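{- Let $n\ge 45$ be an integer and let $D=(d_1,\dots,d_n)$ be a sequence of non-negative integers such that $\sum_{i=1}^n d_i$ is divisible by $3$ and, for every $i=1,\dots,n$, $$\frac{2\left\lfloor\frac{n}{3}\right\rfloor^2}{7}+4\left\lceil\frac{n}{5}\right\rceil+1\ \le\ d_i\ \le\ \frac{5\left\lfloor\frac{n}{3}\right\rfloor^2}{7}.$$ Then $D$ is graphic, i.e. there is a $3$-uniform hypergraph on $n$ vertices whose degree sequence is $D$.
   Context: A $3$-uniform hypergraph $H=(V,E)$ consists of a finite vertex set $V$ and a set $E$ of $3$-element subsets of $V$ (the hyperedges; no hyperedge is repeated). A hyperedge $e$ is incident with a vertex $v$ if $v\in e$. The degree of a vertex is the number of hyperedges incident with it, and the degree sequence of $H$ is the sequence of the degrees of its vertices. A sequence $D=(d_1,\dots,d_n)$ of non-negative integers is graphic (as a $3$-uniform hypergraph degree sequence) if there is a $3$-uniform hypergraph on vertices $v_1,\dots,v_n$, called a realization of $D$, in which $v_i$ has degree $d_i$ for every $i$. -}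

module Defs where

open import Data.Fin using (Fin)
open import Data.Fin.Subset using (Subset; ∣_∣)
open import Data.Fin.Subset.Properties using (_∈?_)
open import Data.List using (List; length; filter)
open import Data.List.Relation.Unary.All using (All)
open import Data.List.Relation.Unary.Unique.Propositional using (Unique)
open import Data.Nat using (ℕ; _+_; _/_; pred; NonZero)
open import Data.Product using (∃-syntax)
open import Data.Vec using (Vec; lookup)
open import Relation.Binary.PropositionalEquality using (_≡_)

-- The finite set of hyperedges is a duplicate-free list. Subsets of Fin n are
-- Boolean vectors, so propositional equality of subsets is extensional and
-- Unique forbids repeated hyperedges.
record Hypergraph₃ (n : ℕ) : Set where
  field
    edges    : List (Subset n)
    distinct : Unique edges
    uniform  : All (λ e → ∣ e ∣ ≡ 3) edges

open Hypergraph₃ public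

degree : ∀ {n} → Hypergraph₃ n → Fin n → ℕ
degree H v = length (filter (v ∈?_) (edges H))

_Realizes_ : ∀ {n} → Hypergraph₃ n → Vec ℕ n → Set
H Realizes D = ∀ i → degree H i ≡ lookup D i

Graphic : ∀ {n} → Vec ℕ n → Set
Graphic {n} D = ∃[ H ] (H Realizes D)

⌊_÷_⌋ : (m d : ℕ) .{{_ : NonZero d}} → ℕ
⌊ m ÷ d ⌋ = m / d

⌈_÷_⌉ : (m d : ℕ) .{{_ : NonZero d}} → ℕ
⌈ m ÷ d ⌉ = (m + pred d) / d

{-# OPTIONS --safe #-}
module Submission where

-- Let A consist of s vertices with the largest prescribed degrees, s being just large enough
-- for the degrees (s-1)(s-2)/2 of the complete 3-uniform hypergraph on A to reach the upper
-- end of the window; its lower end ensures that this clique has at most m = (∑ dᵢ)/3 edges.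
-- Starting from the clique, suppose that some w ∉ A has too small a degree. With fewer than
-- m edges, add an edge {w} ∪ {two vertices of A}. With exactly m edges, some u has too large
-- a degree; then u ∈ A, so deg u > d_u ≥ d_w > deg w and an edge can be moved from u to w.
-- Degrees in A never drop below their targets and degrees outside A never exceed them.

open import Defs
open import Data.Bool using (true; false; if_then_else_)
import Data.Bool.Properties as Bool
open import Data.Fin using (Fin; zero; suc)
import Data.Fin.Properties as Fin
open import Data.Fin.Permutation using (Permutation′; _⟨$⟩ʳ_; _⟨$⟩ˡ_; inverseʳ; transpose)
open import Data.Fin.Subset using (Subset; inside; outside; _∈_; _∉_; _⊆_; ∣_∣; ⊤; ⊥)
open import Data.Fin.Subset.Properties using (_∈?_; out⊆; in⊆in; ∉⊥; ∣⊥∣≡0; ∣⊤∣≡n; p⊆q⇒∣p∣≤∣q∣)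
open import Data.List using (List; []; _∷_; _++_; length; filter; map; allFin)
open import Data.List.Extrema.Nat using (argmax; argmax-all; f[xs]≤f[argmax])
open import Data.List.Membership.Propositional using (find) renaming (_∈_ to _∈ₗ_; _∉_ to _∉ₗ_)
open import Data.List.Membership.Propositional.Properties using (∈-∃++; ∈-filter⁺; ∈-filter⁻; ∈-map⁻; ∈-allFin)
open import Data.List.Properties using (length-map; length-++; filter-++; filter-none)
open import Data.List.Relation.Binary.Permutation.Propositional using (_↭_; ↭-sym; ↭⇒↭ₛ)
open import Data.List.Relation.Binary.Permutation.Propositional.Properties using (shift; ↭-length; filter-↭; ∈-resp-↭; All-resp-↭)
import Data.List.Relation.Binary.Permutation.Setoid.Properties as Permₛ
open import Data.List.Relation.Binary.Subset.Propositional using () renaming (_⊆_ to _⊆ₗ_)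
open import Data.List.Relation.Unary.All as All using (All; []; _∷_)
import Data.List.Relation.Unary.All.Properties as All
open import Data.List.Relation.Unary.AllPairs using ([]; _∷_)
open import Data.List.Relation.Unary.Any as Any using (here; there)
open import Data.List.Relation.Unary.Unique.Propositional using (Unique)
import Data.List.Relation.Unary.Unique.Propositional.Properties as Unique
open import Data.Integer using (+_)
import Data.Integer as ℤ
import Data.Integer.Properties as ℤ
open import Data.Nat using (ℕ; zero; suc; pred; _+_; _*_; _∸_; _^_; _%_; _≤_; _<_; _≥_; z≤n; s≤s; s≤s⁻¹; z<s)
open import Data.Nat.Combinatorics using (_C_; nC1≡n; nCk+nC[k+1]≡[n+1]C[k+1])
open import Data.Nat.Divisibility using (_∣_; divides)
open import Data.Nat.DivMod using (m≡m%n+[m/n]*n; m%n<n; m/n*n≤m; /-monoˡ-≤)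
open import Data.Nat.Properties
open import Data.Nat.Tactic.RingSolver using (solve-∀)
open import Data.Rational.Unnormalised using (_/_) renaming (_≤_ to _≤ℚ_; _+_ to _+ℚ_)
open import Data.Rational.Unnormalised.Properties using (drop-*≤*)
open import Data.Product using (∃-syntax; _×_; _,_; proj₂)
open import Data.Sum using (inj₁; inj₂)
open import Data.Vec using (Vec; sum; []; _∷_; lookup; tabulate; _[_]≔_; here; there)
open import Data.Vec.Properties using (lookup∘tabulate; tabulate∘lookup; tabulate-cong; []=⇒lookup; lookup⇒[]=; lookup∘update; lookup∘update′; ≡-dec; ∷-injectiveʳ)
open import Function using (_∘_; id)
open import Relation.Binary.PropositionalEquality hiding ([_])
open import Relation.Nullary using (¬_; Dec; yes; no; does; contradiction; ¬?)
open import Relation.Nullary.Decidable using (_×-dec_)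
open import Algebra.Properties.CommutativeMonoid.Sum +-0-commutativeMonoid
  using (sum-cong-≗; ∑-distrib-+; sum-permute; sum-replicate-zero) renaming (sum to ∑)

private
  variable
    n : ℕ

-- Finite sums of naturals over `Fin n`.

∑-mono : {f g : Fin n → ℕ} → (∀ v → f v ≤ g v) → ∑ f ≤ ∑ g
∑-mono {zero}  f≤g = z≤n
∑-mono {suc n} f≤g = +-mono-≤ (f≤g zero) (∑-mono (f≤g ∘ suc))

∑-mono-< : {f g : Fin n → ℕ} → (∀ v → f v ≤ g v) → ∀ w → f w < g w → ∑ f < ∑ g
∑-mono-< f≤g zero    fw<gw = +-mono-<-≤ fw<gw (∑-mono (f≤g ∘ suc))
∑-mono-< f≤g (suc w) fw<gw = +-mono-≤-< (f≤g zero) (∑-mono-< (f≤g ∘ suc) w fw<gw)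

-- A strict inequality at one vertex would make the sums strictly different. This is how targets met
-- from above, together with a bound on the number of edges, become a realization.
≤∧∑≥⇒≗ : {f g : Fin n → ℕ} → (∀ v → f v ≤ g v) → ∑ g ≤ ∑ f → f ≗ g
≤∧∑≥⇒≗ f≤g ∑g≤∑f v with m≤n⇒m<n∨m≡n (f≤g v)
... | inj₁ fv<gv = contradiction ∑g≤∑f (<⇒≱ (∑-mono-< f≤g v fv<gv))
... | inj₂ fv≡gv = fv≡gv

∑-const : ∀ n c → ∑ {n} (λ _ → c) ≡ n * c
∑-const zero    c = refl
∑-const (suc n) c = cong (λ s → c + s) (∑-const n c)

∑-*ˡ : ∀ c (f : Fin n → ℕ) → ∑ (λ v → c * f v) ≡ c * ∑ f
∑-*ˡ {zero}  c f = sym (*-zeroʳ c)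
∑-*ˡ {suc n} c f = trans (cong (λ s → c * f zero + s) (∑-*ˡ c (f ∘ suc))) (sym (*-distribˡ-+ c (f zero) _))

∑-suc-at : {f g : Fin n → ℕ} (w : Fin n) → f w ≡ suc (g w) → (∀ v → v ≢ w → f v ≡ g v) → ∑ f ≡ suc (∑ g)
∑-suc-at zero    fw off = cong₂ _+_ fw (sum-cong-≗ (λ v → off (suc v) λ ()))
∑-suc-at {f = f} {g} (suc w) fw off = trans
  (cong₂ _+_ (off zero λ ()) (∑-suc-at w fw (λ v v≢w → off (suc v) (v≢w ∘ Fin.suc-injective))))
  (+-suc (g zero) _)

-- Degrees as sums of incidence indicators.

deg : List (Subset n) → Fin n → ℕ
deg es v = length (filter (v ∈?_) es)

-- Reading the Boolean with `lookup` instead of deciding membership lets the indicator compute on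
-- `x ∷ e` and rewrite along `lookup-permute`.
[_∈_] : Fin n → Subset n → ℕ
[ v ∈ e ] = if lookup e v then 1 else 0

does-∈? : ∀ (v : Fin n) e → does (v ∈? e) ≡ lookup e v
does-∈? zero    (inside  ∷ e) = refl
does-∈? zero    (outside ∷ e) = refl
does-∈? (suc v) (x ∷ e)       = does-∈? v e

deg-∷ : ∀ e es (v : Fin n) → deg (e ∷ es) v ≡ [ v ∈ e ] + deg es v
deg-∷ e es v rewrite sym (does-∈? v e) with does (v ∈? e)
... | true  = refl
... | false = refl

[∈]≡1 : {v : Fin n} {e : Subset n} → v ∈ e → [ v ∈ e ] ≡ 1
[∈]≡1 v∈e rewrite []=⇒lookup v∈e = refl

[∈]≡0 : {v : Fin n} {e : Subset n} → v ∉ e → [ v ∈ e ] ≡ 0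
[∈]≡0 {v = v} {e} v∉e with lookup e v in eq
... | true  = contradiction (lookup⇒[]= v e eq) v∉e
... | false = refl

∑[∈] : (e : Subset n) → ∑ (λ v → [ v ∈ e ]) ≡ ∣ e ∣
∑[∈] []            = refl
∑[∈] (inside  ∷ e) = cong suc (∑[∈] e)
∑[∈] (outside ∷ e) = ∑[∈] e

handshake : ∀ {k} {es : List (Subset n)} → All (λ e → ∣ e ∣ ≡ k) es → ∑ (deg es) ≡ k * length es
handshake {n = n} {k} [] = trans (sum-replicate-zero n) (sym (*-zeroʳ k))
handshake {k = k} {es = e ∷ es} (∣e∣≡k ∷ ∣es∣≡k) = begin
  ∑ (deg (e ∷ es))                       ≡⟨ sum-cong-≗ (deg-∷ e es) ⟩
  ∑ (λ v → [ v ∈ e ] + deg es v)         ≡⟨ ∑-distrib-+ [_∈ e ] (deg es) ⟩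
  ∑ [_∈ e ] + ∑ (deg es)                 ≡⟨ cong₂ _+_ (trans (∑[∈] e) ∣e∣≡k) (handshake ∣es∣≡k) ⟩
  k + k * length es                      ≡⟨ *-suc k (length es) ⟨
  k * suc (length es)                    ∎
  where open ≡-Reasoning

deg-↭ : {es fs : List (Subset n)} → es ↭ fs → deg es ≗ deg fs
deg-↭ es↭fs v = ↭-length (filter-↭ (v ∈?_) es↭fs)

-- Duplicate-free lists and missing edges.

module _ {A : Set} where

  ∈⇒↭∷ : {x : A} {xs : List A} → x ∈ₗ xs → ∃[ ys ] xs ↭ x ∷ ys
  ∈⇒↭∷ x∈xs with as , bs , refl ← ∈-∃++ x∈xs = as ++ bs , shift _ as bs

  -- Delete the head `x` of `xs` from `ys`: the tail of `xs` avoids `x`, so it still lies in what is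
  -- left.
  Unique⇒length≤ : {xs ys : List A} → Unique xs → xs ⊆ₗ ys → length xs ≤ length ys
  Unique⇒length≤ [] _ = z≤n
  Unique⇒length≤ {x ∷ xs} (x∉xs ∷ xs!) xs⊆ys with zs , ys↭x∷zs ← ∈⇒↭∷ (xs⊆ys (here refl)) =
    ≤-trans (s≤s (Unique⇒length≤ xs! xs⊆zs)) (≤-reflexive (sym (↭-length ys↭x∷zs)))
    where
    xs⊆zs : xs ⊆ₗ zs
    xs⊆zs z∈xs with ∈-resp-↭ ys↭x∷zs (xs⊆ys (there z∈xs))
    ... | here refl  = contradiction refl (All.lookup x∉xs z∈xs)
    ... | there z∈zs = z∈zs

  Unique-resp-↭ : {xs ys : List A} → xs ↭ ys → Unique xs → Unique ys
  Unique-resp-↭ xs↭ys = Permₛ.Unique-resp-↭ (setoid A) (↭⇒↭ₛ xs↭ys)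

_∈ₗ?_ : (e : Subset n) (es : List (Subset n)) → Dec (e ∈ₗ es)
e ∈ₗ? es = Any.any? (≡-dec Bool._≟_ e) es

-- Otherwise the edges of `fs` at `v` would form a duplicate-free list inside the shorter list of
-- edges of `es` at `v`. Both kinds of step, adding and moving an edge, get their new edge from this
-- pigeonhole.
deg<⇒∃ : {es fs : List (Subset n)} (v : Fin n) → Unique fs → deg es v < deg fs v →
         ∃[ f ] f ∈ₗ fs × v ∈ f × f ∉ₗ es
deg<⇒∃ {es = es} {fs} v fs! lt with Any.any? (λ f → (v ∈? f) ×-dec ¬? (f ∈ₗ? es)) fs
... | yes any = find any
... | no none = contradiction (Unique⇒length≤ (Unique.filter⁺ (v ∈?_) fs!) ⊆es) (<⇒≱ lt)
  where
  ⊆es : filter (v ∈?_) fs ⊆ₗ filter (v ∈?_) es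
  ⊆es {f} f∈ with ∈-filter⁻ (v ∈?_) {xs = fs} f∈ | f ∈ₗ? es
  ... | f∈fs , v∈f | yes f∈es = ∈-filter⁺ (v ∈?_) f∈es v∈f
  ... | f∈fs , v∈f | no f∉es  = contradiction (Any.map (λ { refl → v∈f , f∉es }) f∈fs) none

-- Vertex permutations and moving an edge between vertices.

permute : Permutation′ n → Subset n → Subset n
permute π e = tabulate (λ v → lookup e (π ⟨$⟩ʳ v))

-- `permute π e` is the preimage of `e` under `π`, so degrees get precomposed with `π`. It is
-- applied below to transpositions, for which preimage and image agree.
lookup-permute : ∀ (π : Permutation′ n) e v → lookup (permute π e) v ≡ lookup e (π ⟨$⟩ʳ v)
lookup-permute π e = lookup∘tabulate _

permute-injective : ∀ (π : Permutation′ n) {e f} → permute π e ≡ permute π f → e ≡ f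
permute-injective π {e} {f} eq = trans (sym (tabulate∘lookup e)) (trans (tabulate-cong e≗f) (tabulate∘lookup f))
  where
  open ≡-Reasoning
  e≗f : lookup e ≗ lookup f
  e≗f v = begin
    lookup e v                           ≡⟨ cong (lookup e) (inverseʳ π) ⟨
    lookup e (π ⟨$⟩ʳ (π ⟨$⟩ˡ v))         ≡⟨ lookup-permute π e _ ⟨
    lookup (permute π e) (π ⟨$⟩ˡ v)      ≡⟨ cong (λ g → lookup g _) eq ⟩
    lookup (permute π f) (π ⟨$⟩ˡ v)      ≡⟨ lookup-permute π f _ ⟩
    lookup f (π ⟨$⟩ʳ (π ⟨$⟩ˡ v))         ≡⟨ cong (lookup f) (inverseʳ π) ⟩
    lookup f v                           ∎

[∈permute] : ∀ (π : Permutation′ n) e v → [ v ∈ permute π e ] ≡ [ π ⟨$⟩ʳ v ∈ e ]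
[∈permute] π e v = cong (if_then 1 else 0) (lookup-permute π e v)

∣permute∣ : ∀ (π : Permutation′ n) e → ∣ permute π e ∣ ≡ ∣ e ∣
∣permute∣ π e = begin
  ∣ permute π e ∣                   ≡⟨ ∑[∈] (permute π e) ⟨
  ∑ [_∈ permute π e ]               ≡⟨ sum-cong-≗ ([∈permute] π e) ⟩
  ∑ (λ v → [ π ⟨$⟩ʳ v ∈ e ])        ≡⟨ sum-permute [_∈ e ] π ⟨
  ∑ [_∈ e ]                         ≡⟨ ∑[∈] e ⟩
  ∣ e ∣                             ∎
  where open ≡-Reasoning

deg-map-permute : ∀ (π : Permutation′ n) es v → deg (map (permute π) es) v ≡ deg es (π ⟨$⟩ʳ v)
deg-map-permute π []       v = refl
deg-map-permute π (e ∷ es) v = begin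
  deg (permute π e ∷ map (permute π) es) v                ≡⟨ deg-∷ (permute π e) _ v ⟩
  [ v ∈ permute π e ] + deg (map (permute π) es) v        ≡⟨ cong₂ _+_ ([∈permute] π e v) (deg-map-permute π es v) ⟩
  [ π ⟨$⟩ʳ v ∈ e ] + deg es (π ⟨$⟩ʳ v)                    ≡⟨ deg-∷ e es _ ⟨
  deg (e ∷ es) (π ⟨$⟩ʳ v)                                 ∎
  where open ≡-Reasoning

module _ (i j : Fin n) where

  transpose-iˡ : transpose i j ⟨$⟩ʳ i ≡ j
  transpose-iˡ with i Fin.≟ i
  ... | yes _  = refl
  ... | no i≢i = contradiction refl i≢i

  transpose-iʳ : transpose i j ⟨$⟩ʳ j ≡ i
  transpose-iʳ with j Fin.≟ i
  ... | yes j≡i = j≡i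
  ... | no _ with j Fin.≟ j
  ...   | yes _  = refl
  ...   | no j≢j = contradiction refl j≢j

  transpose-≢ : ∀ {k} → k ≢ i → k ≢ j → transpose i j ⟨$⟩ʳ k ≡ k
  transpose-≢ {k} k≢i k≢j with k Fin.≟ i
  ... | yes k≡i = contradiction k≡i k≢i
  ... | no _ with k Fin.≟ j
  ...   | yes k≡j = contradiction k≡j k≢j
  ...   | no _    = refl

permute-transpose-fixed : ∀ (i j : Fin n) {e} → i ∈ e → j ∈ e → permute (transpose i j) e ≡ e
permute-transpose-fixed i j {e} i∈e j∈e = trans (tabulate-cong fixed) (tabulate∘lookup e)
  where
  fixed : ∀ k → lookup e (transpose i j ⟨$⟩ʳ k) ≡ lookup e k
  fixed k with k Fin.≟ i
  ... | yes refl = trans ([]=⇒lookup j∈e) (sym ([]=⇒lookup i∈e))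
  ... | no _ with k Fin.≟ j
  ...   | yes refl = trans ([]=⇒lookup i∈e) (sym ([]=⇒lookup j∈e))
  ...   | no _     = refl

-- Since `u ∈ e` and `w ∉ e`, the transposition replaces `u` by `w` in `e` and keeps the other two
-- vertices. The image is not yet an edge, so putting it in place of `e` repeats no edge.
switch : (H : Hypergraph₃ n) {u w : Fin n} {e : Subset n} → e ∈ₗ edges H → u ∈ e → w ∉ e →
         permute (transpose u w) e ∉ₗ edges H →
         ∃[ H′ ] length (edges H′) ≡ length (edges H)
           × degree H′ w ≡ suc (degree H w)
           × suc (degree H′ u) ≡ degree H u
           × (∀ v → v ≢ u → v ≢ w → degree H′ v ≡ degree H v)
switch {n} H {u} {w} {e} e∈E u∈e w∉e f∉E with rest , E↭ ← ∈⇒↭∷ e∈E =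
  H′ , sym (↭-length E↭) , dw′ , du′ , dv′
  where
  π : Permutation′ n
  π = transpose u w

  H′ : Hypergraph₃ n
  H′ .edges    = permute π e ∷ rest
  H′ .distinct with _ ∷ rest! ← Unique-resp-↭ E↭ (distinct H) =
    All.¬Any⇒All¬ rest (λ f∈rest → f∉E (∈-resp-↭ (↭-sym E↭) (there f∈rest))) ∷ rest!
  H′ .uniform  with ∣e∣≡3 ∷ ∣rest∣≡3 ← All-resp-↭ E↭ (uniform H) =
    trans (∣permute∣ π e) ∣e∣≡3 ∷ ∣rest∣≡3

  d′ : ∀ v → degree H′ v ≡ [ π ⟨$⟩ʳ v ∈ e ] + deg rest v
  d′ v = trans (deg-∷ (permute π e) rest v) (cong (_+ deg rest v) ([∈permute] π e v))

  d : ∀ v → degree H v ≡ [ v ∈ e ] + deg rest v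
  d v = trans (deg-↭ E↭ v) (deg-∷ e rest v)

  dw′ : degree H′ w ≡ suc (degree H w)
  dw′ = begin
    degree H′ w                         ≡⟨ d′ w ⟩
    [ π ⟨$⟩ʳ w ∈ e ] + deg rest w       ≡⟨ cong (λ x → [ x ∈ e ] + deg rest w) (transpose-iʳ u w) ⟩
    [ u ∈ e ] + deg rest w              ≡⟨ cong (_+ deg rest w) ([∈]≡1 u∈e) ⟩
    suc (deg rest w)                    ≡⟨ cong (λ x → suc (x + deg rest w)) ([∈]≡0 w∉e) ⟨
    suc ([ w ∈ e ] + deg rest w)        ≡⟨ cong suc (d w) ⟨
    suc (degree H w)                    ∎
    where open ≡-Reasoning

  du′ : suc (degree H′ u) ≡ degree H u
  du′ = begin
    suc (degree H′ u)                   ≡⟨ cong suc (d′ u) ⟩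
    suc ([ π ⟨$⟩ʳ u ∈ e ] + deg rest u) ≡⟨ cong (λ x → suc ([ x ∈ e ] + deg rest u)) (transpose-iˡ u w) ⟩
    suc ([ w ∈ e ] + deg rest u)        ≡⟨ cong (λ x → suc (x + deg rest u)) ([∈]≡0 w∉e) ⟩
    suc (deg rest u)                    ≡⟨ cong (_+ deg rest u) ([∈]≡1 u∈e) ⟨
    [ u ∈ e ] + deg rest u              ≡⟨ d u ⟨
    degree H u                          ∎
    where open ≡-Reasoning

  dv′ : ∀ v → v ≢ u → v ≢ w → degree H′ v ≡ degree H v
  dv′ v v≢u v≢w = trans (d′ v) (trans (cong (λ x → [ x ∈ e ] + deg rest v) (transpose-≢ u w v≢u v≢w)) (sym (d v)))

-- If every edge e with u ∈ e ∌ w had its image under the transposition (u w) in H,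
-- that transposition would embed the edges at u into the edges at w.
transfer : (H : Hypergraph₃ n) (u w : Fin n) → degree H w < degree H u →
           ∃[ H′ ] length (edges H′) ≡ length (edges H)
             × degree H′ w ≡ suc (degree H w)
             × suc (degree H′ u) ≡ degree H u
             × (∀ v → v ≢ u → v ≢ w → degree H′ v ≡ degree H v)
transfer {n} H u w dw<du = via (deg<⇒∃ w (Unique.map⁺ (permute-injective π) (distinct H)) dw<dw∘π)
  where
  π : Permutation′ n
  π = transpose u w

  dw<dw∘π : degree H w < deg (map (permute π) (edges H)) w
  dw<dw∘π = <-≤-trans dw<du (≤-reflexive (sym
    (trans (deg-map-permute π (edges H) w) (cong (deg (edges H)) (transpose-iʳ u w)))))

  via : ∃[ f ] f ∈ₗ map (permute π) (edges H) × w ∈ f × f ∉ₗ edges H → _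
  via (f , f∈ , w∈f , f∉E) with e , e∈E , refl ← ∈-map⁻ (permute π) f∈ = switch H e∈E u∈e w∉e f∉E
    where
    u∈e : u ∈ e
    u∈e = lookup⇒[]= u e (trans (cong (lookup e) (sym (transpose-iʳ u w)))
                         (trans (sym (lookup-permute π e w)) ([]=⇒lookup w∈f)))

    -- If `w` were also in `e`, the transposition would fix `e`, and `f` would be an edge of `H`
    -- after all.
    w∉e : w ∉ e
    w∉e w∈e = f∉E (subst (_∈ₗ edges H) (sym (permute-transpose-fixed u w u∈e w∈e)) e∈E)

-- Complete uniform hypergraphs on a vertex set `A`.

subsetsOfSize : Subset n → ℕ → List (Subset n)
subsetsOfSize []            zero    = [] ∷ []
subsetsOfSize []            (suc k) = []
subsetsOfSize (outside ∷ A) k       = map (outside ∷_) (subsetsOfSize A k)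
subsetsOfSize (inside ∷ A)  zero    = map (outside ∷_) (subsetsOfSize A zero)
subsetsOfSize (inside ∷ A)  (suc k) = map (outside ∷_) (subsetsOfSize A (suc k)) ++ map (inside ∷_) (subsetsOfSize A k)

subsetsOfSize-! : ∀ (A : Subset n) k → Unique (subsetsOfSize A k)
subsetsOfSize-! []            zero    = [] ∷ []
subsetsOfSize-! []            (suc k) = []
subsetsOfSize-! (outside ∷ A) k       = Unique.map⁺ ∷-injectiveʳ (subsetsOfSize-! A k)
subsetsOfSize-! (inside ∷ A)  zero    = Unique.map⁺ ∷-injectiveʳ (subsetsOfSize-! A zero)
subsetsOfSize-! (inside ∷ A)  (suc k) = Unique.++⁺
  (Unique.map⁺ ∷-injectiveʳ (subsetsOfSize-! A (suc k)))
  (Unique.map⁺ ∷-injectiveʳ (subsetsOfSize-! A k))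
  λ (e∈ , e∈′) → disjoint (∈-map⁻ _ e∈) (∈-map⁻ _ e∈′)
  where
  disjoint : ∀ {e} → ∃[ f ] f ∈ₗ subsetsOfSize A (suc k) × e ≡ outside ∷ f →
             ¬ (∃[ f ] f ∈ₗ subsetsOfSize A k × e ≡ inside ∷ f)
  disjoint (_ , _ , refl) (_ , _ , ())

subsetsOfSize-size : ∀ (A : Subset n) k → All (λ e → ∣ e ∣ ≡ k) (subsetsOfSize A k)
subsetsOfSize-size []            zero    = refl ∷ []
subsetsOfSize-size []            (suc k) = []
subsetsOfSize-size (outside ∷ A) k       = All.map⁺ (subsetsOfSize-size A k)
subsetsOfSize-size (inside ∷ A)  zero    = All.map⁺ (subsetsOfSize-size A zero)
subsetsOfSize-size (inside ∷ A)  (suc k) =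
  All.++⁺ (All.map⁺ (subsetsOfSize-size A (suc k))) (All.map⁺ (All.map (cong suc) (subsetsOfSize-size A k)))

subsetsOfSize-⊆ : ∀ (A : Subset n) k → All (_⊆ A) (subsetsOfSize A k)
subsetsOfSize-⊆ []            zero    = id ∷ []
subsetsOfSize-⊆ []            (suc k) = []
subsetsOfSize-⊆ (outside ∷ A) k       = All.map⁺ (All.map out⊆ (subsetsOfSize-⊆ A k))
subsetsOfSize-⊆ (inside ∷ A)  zero    = All.map⁺ (All.map out⊆ (subsetsOfSize-⊆ A zero))
subsetsOfSize-⊆ (inside ∷ A)  (suc k) =
  All.++⁺ (All.map⁺ (All.map out⊆ (subsetsOfSize-⊆ A (suc k)))) (All.map⁺ (All.map in⊆in (subsetsOfSize-⊆ A k)))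

length-subsetsOfSize : ∀ (A : Subset n) k → length (subsetsOfSize A k) ≡ ∣ A ∣ C k
length-subsetsOfSize []            zero    = refl
length-subsetsOfSize []            (suc k) = refl
length-subsetsOfSize (outside ∷ A) k       = trans (length-map _ (subsetsOfSize A k)) (length-subsetsOfSize A k)
length-subsetsOfSize (inside ∷ A)  zero    = trans (length-map _ (subsetsOfSize A zero)) (length-subsetsOfSize A zero)
length-subsetsOfSize (inside ∷ A)  (suc k) = begin
  length (map (outside ∷_) (subsetsOfSize A (suc k)) ++ map (inside ∷_) (subsetsOfSize A k))
    ≡⟨ length-++ (map (outside ∷_) (subsetsOfSize A (suc k))) ⟩
  length (map (outside ∷_) (subsetsOfSize A (suc k))) + length (map (inside ∷_) (subsetsOfSize A k))
    ≡⟨ cong₂ _+_ (length-map _ (subsetsOfSize A (suc k))) (length-map _ (subsetsOfSize A k)) ⟩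
  length (subsetsOfSize A (suc k)) + length (subsetsOfSize A k)
    ≡⟨ cong₂ _+_ (length-subsetsOfSize A (suc k)) (length-subsetsOfSize A k) ⟩
  ∣ A ∣ C suc k + ∣ A ∣ C k
    ≡⟨ +-comm (∣ A ∣ C suc k) _ ⟩
  ∣ A ∣ C k + ∣ A ∣ C suc k
    ≡⟨ nCk+nC[k+1]≡[n+1]C[k+1] ∣ A ∣ k ⟩
  suc ∣ A ∣ C suc k ∎
  where open ≡-Reasoning

deg-++ : ∀ es fs (v : Fin n) → deg (es ++ fs) v ≡ deg es v + deg fs v
deg-++ es fs v = trans (cong length (filter-++ (v ∈?_) es fs)) (length-++ (filter (v ∈?_) es))

deg-map-inside-zero : ∀ (es : List (Subset n)) → deg (map (inside ∷_) es) zero ≡ length es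
deg-map-inside-zero []       = refl
deg-map-inside-zero (e ∷ es) = cong suc (deg-map-inside-zero es)

deg-map-outside-zero : ∀ (es : List (Subset n)) → deg (map (outside ∷_) es) zero ≡ 0
deg-map-outside-zero []       = refl
deg-map-outside-zero (e ∷ es) = deg-map-outside-zero es

deg-map-∷-suc : ∀ x es (v : Fin n) → deg (map (x ∷_) es) (suc v) ≡ deg es v
deg-map-∷-suc x []       v = refl
deg-map-∷-suc x (e ∷ es) v = begin
  deg ((x ∷ e) ∷ map (x ∷_) es) (suc v)                ≡⟨ deg-∷ (x ∷ e) (map (x ∷_) es) (suc v) ⟩
  [ v ∈ e ] + deg (map (x ∷_) es) (suc v)              ≡⟨ cong (λ s → [ v ∈ e ] + s) (deg-map-∷-suc x es v) ⟩
  [ v ∈ e ] + deg es v                                 ≡⟨ deg-∷ e es v ⟨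
  deg (e ∷ es) v                                       ∎
  where open ≡-Reasoning

deg-subsetsOfSize-zero : ∀ (A : Subset n) v → deg (subsetsOfSize A 0) v ≡ 0
deg-subsetsOfSize-zero (outside ∷ A) zero    = deg-map-outside-zero (subsetsOfSize A 0)
deg-subsetsOfSize-zero (inside ∷ A)  zero    = deg-map-outside-zero (subsetsOfSize A 0)
deg-subsetsOfSize-zero (outside ∷ A) (suc v) =
  trans (deg-map-∷-suc outside (subsetsOfSize A 0) v) (deg-subsetsOfSize-zero A v)
deg-subsetsOfSize-zero (inside ∷ A)  (suc v) =
  trans (deg-map-∷-suc outside (subsetsOfSize A 0) v) (deg-subsetsOfSize-zero A v)

∈⇒∣p∣≡suc : {A : Subset n} {v : Fin n} → v ∈ A → ∃[ s ] ∣ A ∣ ≡ suc s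
∈⇒∣p∣≡suc here                          = _ , refl
∈⇒∣p∣≡suc {A = inside  ∷ _} (there _)   = _ , refl
∈⇒∣p∣≡suc {A = outside ∷ _} (there v∈A) = ∈⇒∣p∣≡suc v∈A

-- A set of size `suc k` through `v` is `v` with `k` of the other `pred ∣ A ∣` elements. The
-- recursion follows the Boolean vector, so a head in `A` other than `v` splits these sets into
-- those omitting and those containing it, and Pascal's rule recombines the counts.
deg-subsetsOfSize : ∀ (A : Subset n) k {v} → v ∈ A → deg (subsetsOfSize A (suc k)) v ≡ pred ∣ A ∣ C k
deg-subsetsOfSize (inside ∷ A) k here = begin
  deg (map (outside ∷_) (subsetsOfSize A (suc k)) ++ map (inside ∷_) (subsetsOfSize A k)) zero
    ≡⟨ deg-++ (map (outside ∷_) (subsetsOfSize A (suc k))) _ zero ⟩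
  deg (map (outside ∷_) (subsetsOfSize A (suc k))) zero + deg (map (inside ∷_) (subsetsOfSize A k)) zero
    ≡⟨ cong₂ _+_ (deg-map-outside-zero (subsetsOfSize A (suc k))) (deg-map-inside-zero (subsetsOfSize A k)) ⟩
  length (subsetsOfSize A k)
    ≡⟨ length-subsetsOfSize A k ⟩
  ∣ A ∣ C k ∎
  where open ≡-Reasoning
deg-subsetsOfSize (outside ∷ A) k {suc v} (there v∈A) =
  trans (deg-map-∷-suc outside (subsetsOfSize A (suc k)) v) (deg-subsetsOfSize A k v∈A)
deg-subsetsOfSize (inside ∷ A) k {suc v} (there v∈A) = begin
  deg (map (outside ∷_) (subsetsOfSize A (suc k)) ++ map (inside ∷_) (subsetsOfSize A k)) (suc v)
    ≡⟨ deg-++ (map (outside ∷_) (subsetsOfSize A (suc k))) _ (suc v) ⟩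
  deg (map (outside ∷_) (subsetsOfSize A (suc k))) (suc v) + deg (map (inside ∷_) (subsetsOfSize A k)) (suc v)
    ≡⟨ cong₂ _+_ (deg-map-∷-suc outside (subsetsOfSize A (suc k)) v) (deg-map-∷-suc inside (subsetsOfSize A k) v) ⟩
  deg (subsetsOfSize A (suc k)) v + deg (subsetsOfSize A k) v
    ≡⟨ pascal k (proj₂ (∈⇒∣p∣≡suc v∈A)) ⟩
  ∣ A ∣ C k ∎
  where
  open ≡-Reasoning

  pascal : ∀ k {s} → ∣ A ∣ ≡ suc s → deg (subsetsOfSize A (suc k)) v + deg (subsetsOfSize A k) v ≡ ∣ A ∣ C k
  -- Here the second summand comes from the empty set alone, which misses `v`.
  pascal zero        _       = cong₂ _+_ (deg-subsetsOfSize A 0 v∈A) (deg-subsetsOfSize-zero A v)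
  pascal (suc k) {s} ∣A∣≡1+s = begin
    deg (subsetsOfSize A (2 + k)) v + deg (subsetsOfSize A (suc k)) v
      ≡⟨ cong₂ _+_ (deg-subsetsOfSize A (suc k) v∈A) (deg-subsetsOfSize A k v∈A) ⟩
    pred ∣ A ∣ C suc k + pred ∣ A ∣ C k
      ≡⟨ cong (λ t → pred t C suc k + pred t C k) ∣A∣≡1+s ⟩
    s C suc k + s C k
      ≡⟨ +-comm (s C suc k) _ ⟩
    s C k + s C suc k
      ≡⟨ nCk+nC[k+1]≡[n+1]C[k+1] s k ⟩
    suc s C suc k
      ≡⟨ cong (_C suc k) ∣A∣≡1+s ⟨
    ∣ A ∣ C suc k ∎

deg≡0 : ∀ (v : Fin n) {es} → All (v ∉_) es → deg es v ≡ 0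
deg≡0 v v∉es = cong length (filter-none (v ∈?_) v∉es)

-- One-vertex extensions of a vertex set: largest degrees and new edges.

∣[]≔inside∣ : ∀ {A : Subset n} {w} → w ∉ A → ∣ A [ w ]≔ inside ∣ ≡ suc ∣ A ∣
∣[]≔inside∣ {A = outside ∷ A} {zero}  w∉A = refl
∣[]≔inside∣ {A = inside  ∷ A} {zero}  w∉A = contradiction here w∉A
∣[]≔inside∣ {A = outside ∷ A} {suc w} w∉A = ∣[]≔inside∣ (w∉A ∘ there)
∣[]≔inside∣ {A = inside  ∷ A} {suc w} w∉A = cong suc (∣[]≔inside∣ (w∉A ∘ there))

∈-[]≔inside⁻ : ∀ {A : Subset n} {w v} → v ∈ A [ w ]≔ inside → v ≢ w → v ∈ A
∈-[]≔inside⁻ {A = A} {w} {v} v∈ v≢w =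
  lookup⇒[]= v A (trans (sym (lookup∘update′ v≢w A inside)) ([]=⇒lookup v∈))

-- Greedy induction: adjoin a vertex maximizing `f` outside the set found so far. It dominates the
-- remaining outsiders by maximality, and the earlier vertices do so by induction.
∃-largest : (f : Fin n → ℕ) (s : ℕ) → s ≤ n →
            ∃[ A ] ∣ A ∣ ≡ s × (∀ u w → u ∈ A → w ∉ A → f w ≤ f u)
∃-largest {n} f zero    _   = ⊥ , ∣⊥∣≡0 n , λ u w u∈⊥ → contradiction u∈⊥ ∉⊥
∃-largest {n} f (suc s) s<n with A , refl , A-top ← ∃-largest f s (<⇒≤ s<n)
                            with Fin.any? (λ w → ¬? (w ∈? A))
... | no none = contradiction s<n (≤⇒≯ (≤-trans (≤-reflexive (sym (∣⊤∣≡n n))) (p⊆q⇒∣p∣≤∣q∣ ⊤⊆A)))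
  where
  ⊤⊆A : ⊤ ⊆ A
  ⊤⊆A {v} _ with v ∈? A
  ... | yes v∈A = v∈A
  ... | no v∉A  = contradiction (v , v∉A) none
... | yes (w₀ , w₀∉A) = A [ w₁ ]≔ inside , ∣[]≔inside∣ w₁∉A , top
  where
  outsiders : List (Fin n)
  outsiders = filter (λ w → ¬? (w ∈? A)) (allFin n)

  w₁ : Fin n
  -- `argmax` needs a default; `w₀`, itself outside `A`, keeps the result outside `A`.
  w₁ = argmax f w₀ outsiders

  w₁∉A : w₁ ∉ A
  w₁∉A = argmax-all f w₀∉A (All.all-filter (λ w → ¬? (w ∈? A)) (allFin n))

  ∉A : ∀ {w} → w ∉ A [ w₁ ]≔ inside → w ∉ A
  ∉A {w} w∉ w∈A = w∉ (lookup⇒[]= w _ (trans (lookup∘update′ (λ { refl → w₁∉A w∈A }) A inside) ([]=⇒lookup w∈A)))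

  top : ∀ u w → u ∈ A [ w₁ ]≔ inside → w ∉ A [ w₁ ]≔ inside → f w ≤ f u
  top u w u∈ w∉ with u Fin.≟ w₁
  ... | yes refl = All.lookup (f[xs]≤f[argmax] w₀ outsiders) (∈-filter⁺ (λ w → ¬? (w ∈? A)) (∈-allFin w) (∉A w∉))
  ... | no u≢w₁ = A-top u w (∈-[]≔inside⁻ u∈ u≢w₁) (∉A w∉)

-- Inside `A` with `w` adjoined, `w` lies in `∣ A ∣ C 2` triples, more than its degree in `H`, so
-- one of them is missing from `H`. Its other two vertices are in `A`, which is why no other degree
-- outside `A` changes.
addEdge : (H : Hypergraph₃ n) (A : Subset n) {w : Fin n} → w ∉ A → degree H w < ∣ A ∣ C 2 →
          ∃[ H′ ] length (edges H′) ≡ suc (length (edges H))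
            × degree H′ w ≡ suc (degree H w)
            × (∀ v → v ∉ A → v ≢ w → degree H′ v ≡ degree H v)
            × (∀ v → degree H v ≤ degree H′ v)
addEdge {n} H A {w} w∉A dw< = via (deg<⇒∃ w (subsetsOfSize-! A∪w 3) (<-≤-trans dw< (≤-reflexive (sym dw≡))))
  where
  A∪w : Subset n
  A∪w = A [ w ]≔ inside

  dw≡ : deg (subsetsOfSize A∪w 3) w ≡ ∣ A ∣ C 2
  dw≡ = trans (deg-subsetsOfSize A∪w 2 (lookup⇒[]= w A∪w (lookup∘update w A inside)))
              (cong (λ s → pred s C 2) (∣[]≔inside∣ w∉A))

  via : ∃[ e ] e ∈ₗ subsetsOfSize A∪w 3 × w ∈ e × e ∉ₗ edges H → _
  via (e , e∈ , w∈e , e∉E) = H′ , refl , dw′ , dv′ , d≤d′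
    where
    H′ : Hypergraph₃ n
    H′ .edges    = e ∷ edges H
    H′ .distinct = All.¬Any⇒All¬ (edges H) e∉E ∷ distinct H
    H′ .uniform  = All.lookup (subsetsOfSize-size A∪w 3) e∈ ∷ uniform H

    dw′ : degree H′ w ≡ suc (degree H w)
    dw′ = trans (deg-∷ e (edges H) w) (cong (_+ degree H w) ([∈]≡1 w∈e))

    dv′ : ∀ v → v ∉ A → v ≢ w → degree H′ v ≡ degree H v
    dv′ v v∉A v≢w = trans (deg-∷ e (edges H) v) (cong (_+ degree H v) ([∈]≡0 v∉e))
      where
      v∉e : v ∉ e
      v∉e v∈e = v∉A (∈-[]≔inside⁻ (All.lookup (subsetsOfSize-⊆ A∪w 3) e∈ v∈e) v≢w)

    d≤d′ : ∀ v → degree H v ≤ degree H′ v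
    d≤d′ v = ≤-trans (m≤n+m (degree H v) [ v ∈ e ]) (≤-reflexive (sym (deg-∷ e (edges H) v)))

-- Repairing the degrees outside `A`.

module _ (D : Fin n → ℕ) (A : Subset n) (A-top : ∀ u w → u ∈ A → w ∉ A → D w ≤ D u)
         (room : ∀ w → D w ≤ ∣ A ∣ C 2) (m : ℕ) (∑D≡3m : ∑ D ≡ 3 * m) where

  -- The sum of these entries is the recursion measure. Vertices of `A` count 0, so their degrees
  -- may change in a step without affecting it; outside `A` degrees stay at most `D`, so `∸` is true
  -- subtraction there.
  deficit : (Fin n → ℕ) → Fin n → ℕ
  deficit d v = if does (v ∈? A) then 0 else D v ∸ d v

  deficit-∈ : ∀ d {v} → v ∈ A → deficit d v ≡ 0
  deficit-∈ d {v} v∈A with v ∈? A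
  ... | yes _  = refl
  ... | no v∉A = contradiction v∈A v∉A

  deficit-∉ : ∀ d {v} → v ∉ A → deficit d v ≡ D v ∸ d v
  deficit-∉ d {v} v∉A with v ∈? A
  ... | yes v∈A = contradiction v∈A v∉A
  ... | no _    = refl

  deficit-step : ∀ {d d′ w} → w ∉ A → d w < D w → d′ w ≡ suc (d w) →
                 (∀ v → v ∉ A → v ≢ w → d′ v ≡ d v) → ∑ (deficit d) ≡ suc (∑ (deficit d′))
  deficit-step {d} {d′} {w} w∉A dw<Dw d′w off = ∑-suc-at w at λ v v≢w → elsewhere v v≢w (v ∈? A)
    where
    at : deficit d w ≡ suc (deficit d′ w)
    at = begin
      deficit d w            ≡⟨ deficit-∉ d w∉A ⟩
      D w ∸ d w              ≡⟨ +-∸-assoc 1 dw<Dw ⟩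
      suc (D w ∸ suc (d w))  ≡⟨ cong (λ x → suc (D w ∸ x)) d′w ⟨
      suc (D w ∸ d′ w)       ≡⟨ cong suc (deficit-∉ d′ w∉A) ⟨
      suc (deficit d′ w)     ∎
      where open ≡-Reasoning

    elsewhere : ∀ v → v ≢ w → Dec (v ∈ A) → deficit d v ≡ deficit d′ v
    elsewhere v v≢w (yes v∈A) = trans (deficit-∈ d v∈A) (sym (deficit-∈ d′ v∈A))
    elsewhere v v≢w (no v∉A)  =
      trans (deficit-∉ d v∉A) (trans (cong (D v ∸_) (sym (off v v∉A v≢w))) (sym (deficit-∉ d′ v∉A)))

  -- Recursion on the total deficit `k`: either move raises one degree outside `A` by one and so
  -- lowers `k` by one, while degrees stay at or above target in `A` and at or below it elsewhere.
  complete : ∀ k (H : Hypergraph₃ n) →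
             (∀ u → u ∈ A → D u ≤ degree H u) → (∀ w → w ∉ A → degree H w ≤ D w) →
             ∑ (deficit (degree H)) ≡ k → length (edges H) ≤ m → m ≤ length (edges H) + k →
             ∃[ H′ ] degree {n} H′ ≗ D
  complete k H D≤d d≤D μ≡k ∣E∣≤m m≤∣E∣+k with Fin.any? (λ w → degree H w <? D w)
  -- All degrees are at least their targets, while their sum `3 * length (edges H)` is at most
  -- `3 * m`, so equality holds at each vertex.
  ... | no none = H , λ v → sym (≤∧∑≥⇒≗ {f = D} (λ v → ≮⇒≥ (λ dv<Dv → none (v , dv<Dv))) ∑d≤∑D v)
    where
    ∑d≤∑D : ∑ (degree H) ≤ ∑ D
    ∑d≤∑D = subst₂ _≤_ (sym (handshake (uniform H))) (sym ∑D≡3m) (*-monoʳ-≤ 3 ∣E∣≤m)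
  ... | yes (w , dw<Dw) with w ∈? A
  ...   | yes w∈A = contradiction (D≤d w w∈A) (<⇒≱ dw<Dw)
  ...   | no w∉A with m ≤? length (edges H)
  ...     | no m≰∣E∣
            with H′ , ∣E′∣ , dw′ , dv′ , d≤d′ ← addEdge H A w∉A (<-≤-trans dw<Dw (room w))
            -- The deficit was positive, so `k = zero` is absurd and only the successor clause
            -- remains.
            with k | trans (sym μ≡k) (deficit-step {d′ = degree H′} w∉A dw<Dw dw′ dv′)
  ...       | suc k | k≡ = complete k H′ D≤d′ d′≤D (sym (suc-injective k≡))
              (subst (_≤ m) (sym ∣E′∣) (≰⇒> m≰∣E∣))
              (≤-trans m≤∣E∣+k (≤-reflexive (trans (+-suc _ k) (cong (_+ k) (sym ∣E′∣)))))
    where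
    D≤d′ : ∀ u → u ∈ A → D u ≤ degree H′ u
    D≤d′ u u∈A = ≤-trans (D≤d u u∈A) (d≤d′ u)

    d′≤D : ∀ v → v ∉ A → degree H′ v ≤ D v
    d′≤D v v∉A with v Fin.≟ w
    ... | yes refl = subst (_≤ D w) (sym dw′) dw<Dw
    ... | no v≢w   = subst (_≤ D v) (sym (dv′ v v∉A v≢w)) (d≤D v v∉A)
  complete k H D≤d d≤D μ≡k ∣E∣≤m m≤∣E∣+k | yes (w , dw<Dw) | no w∉A | yes m≤∣E∣
    with Fin.any? (λ u → D u <? degree H u)
  -- With at least `m` edges, the shortage at `w` must be balanced by an excess at some `u`.
  ... | no none = contradiction ∑D≤∑d (<⇒≱ (∑-mono-< (λ v → ≮⇒≥ (λ Dv<dv → none (v , Dv<dv))) w dw<Dw))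
    where
    ∑D≤∑d : ∑ D ≤ ∑ (degree H)
    ∑D≤∑d = subst₂ _≤_ (sym ∑D≡3m) (sym (handshake (uniform H))) (*-monoʳ-≤ 3 m≤∣E∣)
  ... | yes (u , Du<du) with u ∈? A
  ...   | no u∉A = contradiction (d≤D u u∉A) (<⇒≱ Du<du)
  ...   | yes u∈A
          with H′ , ∣E′∣ , dw′ , du′ , dv′ ← transfer H u w (<-trans dw<Dw (≤-<-trans (A-top u w u∈A w∉A) Du<du))
          with k | trans (sym μ≡k) (deficit-step {d′ = degree H′} w∉A dw<Dw dw′
                     (λ v v∉A → dv′ v λ { refl → v∉A u∈A }))
  ...     | suc k | k≡ = complete k H′ D≤d′ d′≤D (sym (suc-injective k≡))
            (subst (_≤ m) (sym ∣E′∣) ∣E∣≤m)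
            (≤-trans m≤∣E∣ (≤-trans (≤-reflexive (sym ∣E′∣)) (m≤m+n _ k)))
    where
    D≤d′ : ∀ v → v ∈ A → D v ≤ degree H′ v
    D≤d′ v v∈A with v Fin.≟ u
    -- The excess at `u` was strict, so losing one edge leaves it at or above its target.
    ... | yes refl = s≤s⁻¹ (subst (D u <_) (sym du′) Du<du)
    ... | no v≢u   = subst (D v ≤_) (sym (dv′ v v≢u λ { refl → w∉A v∈A })) (D≤d v v∈A)

    d′≤D : ∀ v → v ∉ A → degree H′ v ≤ D v
    d′≤D v v∉A with v Fin.≟ w
    ... | yes refl = subst (_≤ D w) (sym dw′) dw<Dw
    ... | no v≢w   = subst (_≤ D v) (sym (dv′ v (λ { refl → v∉A u∈A }) v≢w)) (d≤D v v∉A)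

-- The bound `t C 2` serves twice. It is the degree in the clique on `suc t` vertices, so the
-- vertices of `A` start at or above target; and it is at most `∣ A ∣ C 2`, so a vertex outside `A`
-- short of its target has a free triple.
realize : (D : Fin n → ℕ) (t m : ℕ) → ∑ D ≡ 3 * m → suc t ≤ n → (∀ v → D v ≤ t C 2) → suc t C 3 ≤ m →
          ∃[ H ] degree {n} H ≗ D
realize {n} D t m ∑D≡3m t<n D≤ ∣E∣≤m with A , ∣A∣≡1+t , A-top ← ∃-largest D (suc t) t<n =
  complete D A A-top room m ∑D≡3m (∑ μ) clique D≤d d≤D refl
    (≤-trans (≤-reflexive ∣E∣≡) ∣E∣≤m) (*-cancelˡ-≤ 3 3m≤)
  where
  clique : Hypergraph₃ n
  clique .edges    = subsetsOfSize A 3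
  clique .distinct = subsetsOfSize-! A 3
  clique .uniform  = subsetsOfSize-size A 3

  ∣E∣≡ : length (edges clique) ≡ suc t C 3
  ∣E∣≡ = trans (length-subsetsOfSize A 3) (cong (_C 3) ∣A∣≡1+t)

  room : ∀ v → D v ≤ ∣ A ∣ C 2
  room v = begin
    D v              ≤⟨ D≤ v ⟩
    t C 2            ≤⟨ m≤n+m (t C 2) (t C 1) ⟩
    t C 1 + t C 2    ≡⟨ nCk+nC[k+1]≡[n+1]C[k+1] t 1 ⟩
    suc t C 2        ≡⟨ cong (_C 2) ∣A∣≡1+t ⟨
    ∣ A ∣ C 2        ∎
    where open ≤-Reasoning

  D≤d : ∀ u → u ∈ A → D u ≤ degree clique u
  D≤d u u∈A = ≤-trans (D≤ u) (≤-reflexive (sym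
    (trans (deg-subsetsOfSize A 2 u∈A) (cong (λ s → pred s C 2) ∣A∣≡1+t))))

  d≤D : ∀ w → w ∉ A → degree clique w ≤ D w
  d≤D w w∉A = ≤-trans (≤-reflexive (deg≡0 w (All.map (λ e⊆A w∈e → w∉A (e⊆A w∈e)) (subsetsOfSize-⊆ A 3)))) z≤n

  μ : Fin n → ℕ
  μ = deficit D A A-top room m ∑D≡3m (degree clique)

  -- The factor 3 is slack at each vertex; it matches the 3 of `handshake`, so that 3 cancels after
  -- summation.
  D≤d+3μ : ∀ v → D v ≤ degree clique v + 3 * μ v
  D≤d+3μ v with v ∈? A
  ... | yes v∈A = ≤-trans (D≤d v v∈A) (m≤m+n _ _)
  ... | no v∉A  = begin
    D v                                             ≡⟨ m+[n∸m]≡n (d≤D v v∉A) ⟨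
    degree clique v + (D v ∸ degree clique v)       ≤⟨ +-monoʳ-≤ (degree clique v) (m≤n*m _ 3) ⟩
    degree clique v + 3 * (D v ∸ degree clique v)   ∎
    where open ≤-Reasoning

  3m≤ : 3 * m ≤ 3 * (length (edges clique) + ∑ μ)
  3m≤ = begin
    3 * m                                      ≡⟨ ∑D≡3m ⟨
    ∑ D                                        ≤⟨ ∑-mono D≤d+3μ ⟩
    ∑ (λ v → degree clique v + 3 * μ v)        ≡⟨ ∑-distrib-+ (degree clique) (λ v → 3 * μ v) ⟩
    ∑ (degree clique) + ∑ (λ v → 3 * μ v)      ≡⟨ cong₂ _+_ (handshake (uniform clique)) (∑-*ˡ 3 μ) ⟩
    3 * length (edges clique) + 3 * ∑ μ        ≡⟨ *-distribˡ-+ 3 (length (edges clique)) (∑ μ) ⟨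
    3 * (length (edges clique) + ∑ μ)          ∎
    where open ≤-Reasoning

-- Arithmetic of the degree window.

2*nC2 : ∀ r → 2 * (suc r C 2) ≡ suc r * r
2*nC2 zero    = refl
2*nC2 (suc r) = step (suc r C 1) (suc r C 2) (nC1≡n (suc r)) (2*nC2 r) (nCk+nC[k+1]≡[n+1]C[k+1] (suc r) 1)
  where
  open ≡-Reasoning
  regroup : ∀ r → 2 * suc r + suc r * r ≡ (2 + r) * suc r
  regroup = solve-∀

  step : ∀ x y {z} → x ≡ suc r → 2 * y ≡ suc r * r → x + y ≡ z → 2 * z ≡ (2 + r) * suc r
  step x y x≡ 2y≡ refl = begin
    2 * (x + y)              ≡⟨ *-distribˡ-+ 2 x y ⟩
    2 * x + 2 * y            ≡⟨ cong₂ (λ s t → 2 * s + t) x≡ 2y≡ ⟩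
    2 * suc r + suc r * r    ≡⟨ regroup r ⟩
    (2 + r) * suc r          ∎

6*nC3 : ∀ r → 6 * (suc (suc r) C 3) ≡ suc (suc r) * (suc r * r)
6*nC3 zero    = refl
6*nC3 (suc r) = step ((2 + r) C 2) ((2 + r) C 3) (2*nC2 (suc r)) (6*nC3 r) (nCk+nC[k+1]≡[n+1]C[k+1] (2 + r) 2)
  where
  open ≡-Reasoning
  distribute : ∀ x y → 6 * (x + y) ≡ 3 * (2 * x) + 6 * y
  distribute = solve-∀

  regroup : ∀ r → 3 * ((2 + r) * suc r) + (2 + r) * (suc r * r) ≡ (3 + r) * ((2 + r) * suc r)
  regroup = solve-∀

  step : ∀ x y {z} → 2 * x ≡ (2 + r) * suc r → 6 * y ≡ (2 + r) * (suc r * r) → x + y ≡ z →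
         6 * z ≡ (3 + r) * ((2 + r) * suc r)
  step x y 2x≡ 6y≡ refl = begin
    6 * (x + y)                                          ≡⟨ distribute x y ⟩
    3 * (2 * x) + 6 * y                                  ≡⟨ cong₂ (λ s t → 3 * s + t) 2x≡ 6y≡ ⟩
    3 * ((2 + r) * suc r) + (2 + r) * (suc r * r)        ≡⟨ regroup r ⟩
    (3 + r) * ((2 + r) * suc r)                          ∎

-- Downward search from `j`: the first value met that is at most `N` has its upper neighbour above
-- `N`.
crossing : ∀ (f : ℕ → ℕ) N j → f 0 ≤ N → N < f j → ∃[ r ] f r ≤ N × N < f (suc r)
crossing f N zero    f0≤N N<f0 = contradiction f0≤N (<⇒≱ N<f0)
crossing f N (suc j) f0≤N N<f[1+j] with f j ≤? N
... | yes fj≤N = j , fj≤N , N<f[1+j]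
... | no fj≰N  = crossing f N j f0≤N (≰⇒> fj≰N)

module _ {k r : ℕ} (r[1+r]≤ : 7 * (r * suc r) ≤ 10 * (k * k)) where

  -- `6/5` is just above the square root of `10/7`: `7 * 36 = 252` exceeds `25 * 10 = 250`. If
  -- `5 * r` were at least `6 * k + 1`, squaring would contradict the bound on `r * suc r`.
  5r≤6k : 5 * r ≤ 6 * k
  5r≤6k = ≮⇒≥ λ 6k<5r → <-irrefl refl (begin-strict
    250 * (k * k)                                 <⟨ m<m+n (250 * (k * k)) (<-≤-trans z<s (m≤n+m 7 (2 * (k * k) + 84 * k))) ⟩
    250 * (k * k) + (2 * (k * k) + 84 * k + 7)    ≡⟨ square k ⟩
    7 * (suc (6 * k) * suc (6 * k))               ≤⟨ *-monoʳ-≤ 7 (*-mono-≤ 6k<5r 6k<5r) ⟩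
    7 * ((5 * r) * (5 * r))                       ≤⟨ m≤m+n _ (175 * r) ⟩
    7 * ((5 * r) * (5 * r)) + 175 * r             ≡⟨ regroup r ⟩
    25 * (7 * (r * suc r))                        ≤⟨ *-monoʳ-≤ 25 r[1+r]≤ ⟩
    25 * (10 * (k * k))                           ≡⟨ *-assoc 25 10 (k * k) ⟨
    250 * (k * k)                                 ∎)
    where
    open ≤-Reasoning
    square : ∀ k → 250 * (k * k) + (2 * (k * k) + 84 * k + 7) ≡ 7 * (suc (6 * k) * suc (6 * k))
    square = solve-∀

    regroup : ∀ r → 7 * ((5 * r) * (5 * r)) + 175 * r ≡ 25 * (7 * (r * suc r))
    regroup = solve-∀

  cube≤ : 2 ≤ k → 35 * ((3 + r) * ((2 + r) * (1 + r))) ≤ 6 * k * (10 * (k * k) + 84 * k + 35)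
  cube≤ 2≤k = begin
    35 * ((3 + r) * ((2 + r) * (1 + r)))
      ≡⟨ regroup r ⟩
    5 * r * (7 * (r * suc r)) + 25 * (7 * (r * suc r)) + 42 * (5 * r) + 210
      ≤⟨ +-monoˡ-≤ 210 (+-mono-≤ (+-mono-≤ (*-mono-≤ 5r≤6k r[1+r]≤) (*-monoʳ-≤ 25 r[1+r]≤)) (*-monoʳ-≤ 42 5r≤6k)) ⟩
    6 * k * (10 * (k * k)) + 25 * (10 * (k * k)) + 42 * (6 * k) + 210
      ≤⟨ lower-order k 2≤k ⟩
    6 * k * (10 * (k * k) + 84 * k + 35) ∎
    where
    open ≤-Reasoning
    regroup : ∀ r → 35 * ((3 + r) * ((2 + r) * (1 + r)))
                  ≡ 5 * r * (7 * (r * suc r)) + 25 * (7 * (r * suc r)) + 42 * (5 * r) + 210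
    regroup = solve-∀

    -- Substituting `k = 2 + j` leaves a difference with natural coefficients only.
    expand : ∀ j → 6 * (2 + j) * (10 * ((2 + j) * (2 + j)) + 84 * (2 + j) + 35)
      ≡ (6 * (2 + j) * (10 * ((2 + j) * (2 + j))) + 25 * (10 * ((2 + j) * (2 + j))) + 42 * (6 * (2 + j)) + 210)
        + (722 + 974 * j + 254 * (j * j))
    expand = solve-∀

    lower-order : ∀ k → 2 ≤ k → 6 * k * (10 * (k * k)) + 25 * (10 * (k * k)) + 42 * (6 * k) + 210
                              ≤ 6 * k * (10 * (k * k) + 84 * k + 35)
    lower-order (suc (suc j)) (s≤s (s≤s z≤n)) = m+n≤o⇒m≤o _ (≤-reflexive (sym (expand j)))

  -- Ensures that the clique fits into `n ≥ 3 * k` vertices. Five times the claim splits into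
  -- `15 ≤ 9 * k` and `5 * r ≤ 6 * k`.
  3+r≤3k : 2 ≤ k → 3 + r ≤ 3 * k
  3+r≤3k 2≤k = *-cancelˡ-≤ 5 (begin
    5 * (3 + r)       ≡⟨ *-distribˡ-+ 5 3 r ⟩
    15 + 5 * r        ≤⟨ +-mono-≤ (≤-trans (m≤m+n 15 3) (*-monoʳ-≤ 9 2≤k)) 5r≤6k ⟩
    9 * k + 6 * k     ≡⟨ *-distribʳ-+ k 9 6 ⟨
    15 * k            ≡⟨ *-assoc 5 3 k ⟩
    5 * (3 * k)       ∎)
    where open ≤-Reasoning

-- This makes `suc (2 * k)` a valid starting point for the search in `crossing`.
10k²<7j[1+j] : ∀ k → 10 * (k * k) < 7 * (suc (2 * k) * suc (suc (2 * k)))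
10k²<7j[1+j] k = begin-strict
  10 * (k * k)                                   <⟨ m<m+n (10 * (k * k)) (<-≤-trans z<s (m≤n+m 14 (18 * (k * k) + 42 * k))) ⟩
  10 * (k * k) + (18 * (k * k) + 42 * k + 14)    ≡⟨ regroup k ⟩
  7 * (suc (2 * k) * suc (suc (2 * k)))          ∎
  where
  open ≤-Reasoning
  regroup : ∀ k → 10 * (k * k) + (18 * (k * k) + 42 * k + 14) ≡ 7 * (suc (2 * k) * suc (suc (2 * k)))
  regroup = solve-∀

-- `x` stands for `(2 + r) C 2`, the degree in the clique on `3 + r` vertices. As `suc r` violates
-- the bound that `r` satisfies, this degree reaches the upper end of the window.
below-binomial : ∀ k r → 10 * (k * k) < 7 * (suc r * suc (suc r)) → ∀ d x →
                 7 * d ≤ 5 * (k * k) → 2 * x ≡ suc (suc r) * suc r → d ≤ x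
below-binomial k r upper d x 7d≤ 2x≡ = *-cancelˡ-≤ 2 (*-cancelˡ-≤ 7 (begin
  7 * (2 * d)                      ≡⟨ swap-factors d ⟩
  2 * (7 * d)                      ≤⟨ *-monoʳ-≤ 2 7d≤ ⟩
  2 * (5 * (k * k))                ≡⟨ *-assoc 2 5 (k * k) ⟨
  10 * (k * k)                     ≤⟨ <⇒≤ upper ⟩
  7 * (suc r * suc (suc r))        ≡⟨ cong (7 *_) (*-comm (suc r) (suc (suc r))) ⟩
  7 * (suc (suc r) * suc r)        ≡⟨ cong (7 *_) 2x≡ ⟨
  7 * (2 * x)                      ∎))
  where
  open ≤-Reasoning
  swap-factors : ∀ d → 7 * (2 * d) ≡ 2 * (7 * d)
  swap-factors = solve-∀

-- `x` stands for `(3 + r) C 3`, the number of edges of the clique. The lower end of the window,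
-- summed over `3 * k` vertices, bounds `35 * (3 * m)` from below, and `cube≤` compares this with
-- the clique.
cube-bound : ∀ k r m → 2 ≤ k → 7 * (r * suc r) ≤ 10 * (k * k) →
             3 * k * (10 * (k * k) + 84 * k + 35) ≤ 35 * (3 * m) →
             ∀ x → 6 * x ≡ suc (suc (suc r)) * (suc (suc r) * suc r) → x ≤ m
cube-bound k r m 2≤k lower kL≤ x 6x≡ = *-cancelˡ-≤ 6 (*-cancelˡ-≤ 35 (begin
  35 * (6 * x)                                     ≡⟨ cong (35 *_) 6x≡ ⟩
  35 * ((3 + r) * ((2 + r) * (1 + r)))             ≤⟨ cube≤ {k} {r} lower 2≤k ⟩
  6 * k * (10 * (k * k) + 84 * k + 35)             ≡⟨ double k (10 * (k * k) + 84 * k + 35) ⟩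
  2 * (3 * k * (10 * (k * k) + 84 * k + 35))       ≤⟨ *-monoʳ-≤ 2 kL≤ ⟩
  2 * (35 * (3 * m))                               ≡⟨ regroup m ⟩
  35 * (6 * m)                                     ∎))
  where
  open ≤-Reasoning
  double : ∀ k l → 6 * k * l ≡ 2 * (3 * k * l)
  double = solve-∀

  regroup : ∀ m → 2 * (35 * (3 * m)) ≡ 35 * (6 * m)
  regroup = solve-∀

∑-lower-bound : ∀ (D : Fin n → ℕ) {j c l} → j ≤ n → (∀ v → l ≤ c * D v) → j * l ≤ c * ∑ D
∑-lower-bound {n} D {j} {c} {l} j≤n lo = begin
  j * l                       ≤⟨ *-monoˡ-≤ l j≤n ⟩
  n * l                       ≡⟨ ∑-const n l ⟨
  ∑ {n} (λ _ → l)             ≤⟨ ∑-mono lo ⟩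
  ∑ (λ v → c * D v)           ≡⟨ ∑-*ˡ c D ⟩
  c * ∑ D                     ∎
  where open ≤-Reasoning

-- The clique has r + 3 vertices, r being largest with 7 r (r + 1) ≤ 10 k².
realize-window : ∀ (D : Fin n → ℕ) k m → 2 ≤ k → 3 * k ≤ n → ∑ D ≡ 3 * m →
                 (∀ v → 10 * (k * k) + 84 * k + 35 ≤ 35 * D v) → (∀ v → 7 * D v ≤ 5 * (k * k)) →
                 ∃[ H ] degree {n} H ≗ D
realize-window {n} D k m 2≤k 3k≤n ∑D≡3m lo hi =
  from (crossing (λ r → 7 * (r * suc r)) (10 * (k * k)) (suc (2 * k)) z≤n (10k²<7j[1+j] k))
  where
  3k∙lo≤ : 3 * k * (10 * (k * k) + 84 * k + 35) ≤ 35 * (3 * m)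
  3k∙lo≤ = ≤-trans (∑-lower-bound D {c = 35} 3k≤n lo) (≤-reflexive (cong (35 *_) ∑D≡3m))

  from : ∃[ r ] 7 * (r * suc r) ≤ 10 * (k * k) × 10 * (k * k) < 7 * (suc r * suc (suc r)) → ∃[ H ] degree {n} H ≗ D
  from (r , lower , upper) = realize D (suc (suc r)) m ∑D≡3m (≤-trans (3+r≤3k {k} {r} lower 2≤k) 3k≤n)
    (λ v → below-binomial k r upper (D v) (suc (suc r) C 2) (hi v) (2*nC2 (suc r)))
    (cube-bound k r m 2≤k lower 3k∙lo≤ (suc (suc (suc r)) C 3) (6*nC3 (suc r)))

-- From the rational hypotheses to inequalities of naturals.

∑-lookup : (D : Vec ℕ n) → ∑ (lookup D) ≡ sum D
∑-lookup []      = refl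
∑-lookup (x ∷ D) = cong (λ s → x + s) (∑-lookup D)

n≤5⌈n÷5⌉ : ∀ n → n ≤ 5 * ⌈ n ÷ 5 ⌉
n≤5⌈n÷5⌉ n = +-cancelʳ-≤ 4 n (5 * ⌈ n ÷ 5 ⌉) (begin
  n + 4                               ≡⟨ m≡m%n+[m/n]*n (n + 4) 5 ⟩
  (n + 4) % 5 + ⌈ n ÷ 5 ⌉ * 5         ≤⟨ +-monoˡ-≤ _ (s≤s⁻¹ (m%n<n (n + 4) 5)) ⟩
  4 + ⌈ n ÷ 5 ⌉ * 5                   ≡⟨ cong (λ s → 4 + s) (*-comm ⌈ n ÷ 5 ⌉ 5) ⟩
  4 + 5 * ⌈ n ÷ 5 ⌉                   ≡⟨ +-comm 4 _ ⟩
  5 * ⌈ n ÷ 5 ⌉ + 4                   ∎)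
  where open ≤-Reasoning

-- Unnormalised rationals keep their literal denominators, so `drop-*≤*` yields the cross-multiplied
-- integer inequality; the rest moves the casts outward and tidies the products.
degree-lower-bound : ∀ k c d → (+ (2 * k ^ 2)) / 7 +ℚ (+ (4 * c + 1)) / 1 ≤ℚ (+ d) / 1 →
                     2 * (k * k) + 7 * (4 * c + 1) ≤ 7 * d
degree-lower-bound k c d le = subst₂ _≤_ left right (ℤ.drop‿+≤+ (subst₂ ℤ._≤_ left′ (sym (ℤ.pos-* d 7)) (drop-*≤* le)))
  where
  left′ : ((+ (2 * k ^ 2)) ℤ.* + 1 ℤ.+ (+ (4 * c + 1)) ℤ.* + 7) ℤ.* + 1 ≡ + (2 * k ^ 2 + (4 * c + 1) * 7)
  left′ = trans (ℤ.*-identityʳ _) (cong₂ ℤ._+_ (ℤ.*-identityʳ (+ (2 * k ^ 2))) (sym (ℤ.pos-* (4 * c + 1) 7)))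

  left : 2 * k ^ 2 + (4 * c + 1) * 7 ≡ 2 * (k * k) + 7 * (4 * c + 1)
  left = cong₂ _+_ (cong (λ x → 2 * (k * x)) (*-identityʳ k)) (*-comm (4 * c + 1) 7)

  right : d * 7 ≡ 7 * d
  right = *-comm d 7

degree-upper-bound : ∀ k d → (+ d) / 1 ≤ℚ (+ (5 * k ^ 2)) / 7 → 7 * d ≤ 5 * (k * k)
degree-upper-bound k d le = subst₂ _≤_ (*-comm d 7) (cong (λ x → 5 * (k * x)) (*-identityʳ k))
  (ℤ.drop‿+≤+ (subst₂ ℤ._≤_ (sym (ℤ.pos-* d 7)) (ℤ.*-identityʳ (+ (5 * k ^ 2))) (drop-*≤* le)))

theorem4p1 : ∀ (n : ℕ) → n ≥ 45 → (D : Vec ℕ n) → 3 ∣ sum D →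
    (∀ (i : Fin n) → ((+ (2 * ⌊ n ÷ 3 ⌋ ^ 2)) / 7) +ℚ ((+ (4 * ⌈ n ÷ 5 ⌉ + 1)) / 1) ≤ℚ ((+ lookup D i) / 1)) →
    (∀ (i : Fin n) → ((+ lookup D i) / 1) ≤ℚ ((+ (5 * ⌊ n ÷ 3 ⌋ ^ 2)) / 7)) →
    Graphic D
theorem4p1 n n≥45 D (divides m sumD≡m*3) lo hi =
  realize-window (lookup D) k m 2≤k 3k≤n
    (trans (∑-lookup D) (trans sumD≡m*3 (*-comm m 3)))
    lo′ (λ v → degree-upper-bound k (lookup D v) (hi v))
  where
  open ≤-Reasoning
  k c : ℕ
  k = ⌊ n ÷ 3 ⌋
  c = ⌈ n ÷ 5 ⌉

  2≤k : 2 ≤ k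
  -- `45 / 3 = 15` enters as `2 + 13`.
  2≤k = ≤-trans (m≤m+n 2 13) (/-monoˡ-≤ 3 n≥45)

  3k≤n : 3 * k ≤ n
  3k≤n = ≤-trans (≤-reflexive (*-comm 3 k)) (m/n*n≤m n 3)

  lo′ : ∀ v → 10 * (k * k) + 84 * k + 35 ≤ 35 * lookup D v
  -- Scaling by 35 clears the denominators 7 and 5: since `3 * k ≤ n ≤ 5 * c`, the term `4 * c` is
  -- at least `12 * k / 5`, which becomes `84 * k`.
  lo′ v = begin
    10 * (k * k) + 84 * k + 35               ≡⟨ cong (λ x → 10 * (k * k) + x + 35) (*-assoc 28 3 k) ⟩
    10 * (k * k) + 28 * (3 * k) + 35         ≤⟨ +-monoˡ-≤ 35 (+-monoʳ-≤ (10 * (k * k)) (*-monoʳ-≤ 28 (≤-trans 3k≤n (n≤5⌈n÷5⌉ n)))) ⟩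
    10 * (k * k) + 28 * (5 * c) + 35         ≡⟨ regroup k c ⟩
    5 * (2 * (k * k) + 7 * (4 * c + 1))      ≤⟨ *-monoʳ-≤ 5 (degree-lower-bound k c (lookup D v) (lo v)) ⟩
    5 * (7 * lookup D v)                     ≡⟨ *-assoc 5 7 (lookup D v) ⟨
    35 * lookup D v                          ∎
    where
    regroup : ∀ k c → 10 * (k * k) + 28 * (5 * c) + 35 ≡ 5 * (2 * (k * k) + 7 * (4 * c + 1))
    regroup = solve-∀
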